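{- For any directed acyclic graph $D$ on $n\ge 1$ vertices, $F(D)=n-1$.
   Context: A finite simple digraph $D=(V,A)$ has finite nonempty vertex set $V$ and arc set $A$ consisting of ordered pairs of distinct vertices (no loops, no parallel arcs; both $(u,v)$ and $(v,u)$ may be present). $N_D^+(v)=\{u:(v,u)\in A\}$. A directed acyclic graph is a finite simple digraph containing no directed cycle (a closed directed walk $v_1\to v_2\to\cdots\to v_k\to v_1$ through $k\ge 2$ distinct vertices). Zero forcing: for $S\subseteq V$ let $B^0(S)=S$ and $B^{i+1}(S)=B^i(S)\cup\{w:\{w\}=N_D^+(v)\setminus B^i(S)\text{ for some }v\in B^i(S)\}$. $S$ is a zero forcing set (ZFS) if $B^t(S)=V$ for some $t\ge 0$, and a failed zero forcing set (FZFS) otherwise. The failed zero forcing number $F(D)$ is the largest cardinality of an FZFS of $D$. -}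

module Defs where

open import Data.Bool.Properties using () renaming (_≟_ to _≟ᵇ_)
open import Data.Fin.Base using (Fin; zero; suc; fromℕ; inject₁)
open import Data.Fin.Properties using (any?)
open import Data.Fin.Subset using (Subset; _∈_; _∪_; _─_; ⁅_⁆; ∣_∣; ⊤)
open import Data.Fin.Subset.Properties using (_∈?_)
open import Data.Nat.Base using (ℕ; zero; suc; _≤_)
open import Data.Product.Base using (∃-syntax; _×_)
open import Data.Vec.Base using (tabulate)
open import Data.Vec.Properties using (≡-dec)
open import Function.Definitions using (Injective)
open import Level using (0ℓ)
open import Relation.Binary.Core using (Rel)
open import Relation.Binary.Definitions using (Decidable; Irreflexive)
open import Relation.Binary.PropositionalEquality.Core using (_≡_)
open import Relation.Nullary using (¬_; Dec; does; _×-dec_)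

-- The vertex set is Fin n; the arc set is a decidable relation, so there are
-- no parallel arcs, while opposite arcs are allowed.
record Digraph (n : ℕ) : Set₁ where
  field
    Arc      : Rel (Fin n) 0ℓ
    Arc?     : Decidable Arc
    loopless : Irreflexive _≡_ Arc

  N⁺ : Fin n → Subset n
  N⁺ v = tabulate λ u → does (Arc? v u)

-- A closed directed walk v₀ → v₁ → ⋯ → v₁₊ₘ → v₀ through 2 + m distinct
-- vertices.
record DirectedCycle {n : ℕ} (D : Digraph n) : Set where
  open Digraph D
  field
    m        : ℕ
    vertex   : Fin (suc (suc m)) → Fin n
    distinct : Injective _≡_ _≡_ vertex
    step     : ∀ (i : Fin (suc m)) → Arc (vertex (inject₁ i)) (vertex (suc i))
    closing  : Arc (vertex (fromℕ (suc m))) (vertex zero)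

Acyclic : {n : ℕ} → Digraph n → Set
Acyclic D = ¬ DirectedCycle D

module _ {n : ℕ} (D : Digraph n) where
  open Digraph D

  Forces : Subset n → Fin n → Fin n → Set
  Forces S v w = v ∈ S × ⁅ w ⁆ ≡ N⁺ v ─ S

  forced? : (S : Subset n) (w : Fin n) → Dec (∃[ v ] Forces S v w)
  forced? S w = any? λ v → (v ∈? S) ×-dec ≡-dec _≟ᵇ_ ⁅ w ⁆ (N⁺ v ─ S)

  forced : Subset n → Subset n
  forced S = tabulate λ w → does (forced? S w)

  B : ℕ → Subset n → Subset n
  B zero    S = S
  B (suc i) S = B i S ∪ forced (B i S)

  ZFS : Subset n → Set
  ZFS S = ∃[ t ] B t S ≡ ⊤

  FZFS : Subset n → Set
  FZFS S = ¬ ZFS S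

  -- F(D) = k, where F(D) is the largest cardinality of an FZFS: k is attained
  -- and is an upper bound, so at most one k qualifies.  When n = 0 there is no
  -- FZFS and no k qualifies.
  FailedZeroForcingNumberIs : ℕ → Set
  FailedZeroForcingNumberIs k =
    (∃[ S ] FZFS S × ∣ S ∣ ≡ k) × (∀ S → FZFS S → ∣ S ∣ ≤ k)

{-# OPTIONS --safe #-}

-- A finite acyclic digraph has a source s: otherwise walking backwards along
-- arcs repeats a vertex, and a repetition with minimal gap is a directed cycle.
-- A source is never forced, so V ∖ {s} fails; the only larger set is V itself.
module Submission where

open import Defs
open import Data.Nat
  using (ℕ; zero; suc; _+_; _∸_; _≤_; _<_; _≥_; z<s; s≤s⁻¹)
open import Data.Nat.Induction using (<-rec)
open import Data.Nat.Properties
  using ( +-suc; +-assoc; m∸n+n≡m; ∸-monoʳ-<; <-≤-trans; <-cmp; _<?_; n<1+n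
        ; m≤n⇒m<n∨m≡n; <⇒≤pred)
open import Data.Fin.Base
  using (Fin; zero; suc; fromℕ; inject₁; toℕ; opposite)
open import Data.Fin.Properties
  using ( any?; _≟_; pigeonhole; opposite-involutive; toℕ-fromℕ; toℕ-inject₁
        ; toℕ<n; toℕ-injective)
open import Data.Fin.Subset using (_∈_; _∉_; ⁅_⁆; ∁; ∣_∣)
open import Data.Fin.Subset.Properties
  using ( x∈p∪q⁻; p─q⊆p; x∈⁅x⁆; ∈⊤; x∈p⇒x∉∁p; ∣∁p∣≡n∸∣p∣; ∣⁅x⁆∣≡1; ∣p∣≤n
        ; ∣p∣≡n⇒p≡⊤)
open import Data.Product.Base using (∃; ∃-syntax; _,_; proj₁; proj₂)
open import Data.Sum.Base using (inj₁; inj₂)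
open import Data.Vec.Base using (tabulate)
open import Data.Vec.Properties using (lookup∘tabulate; []=⇒lookup)
open import Function.Base using (_∘_)
open import Function.Definitions using (Injective)
open import Level using (Level)
open import Relation.Binary.Definitions using (tri<; tri≈; tri>)
open import Relation.Binary.PropositionalEquality
  using (_≡_; refl; sym; trans; cong; subst; subst₂)
open import Relation.Nullary
  using (¬_; does; yes; no; contradiction; decidable-stable; ¬?; _×-dec_)
open import Relation.Unary using (Pred; Decidable)

private
  variable
    n : ℕ
    ℓ : Level

∈-tabulate-does⁻ : {P : Pred (Fin n) ℓ} (P? : Decidable P) {x : Fin n} →
                   x ∈ tabulate (does ∘ P?) → P x
∈-tabulate-does⁻ P? {x} x∈
  with P? x | trans (sym (lookup∘tabulate (does ∘ P?) x)) ([]=⇒lookup x∈)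
... | yes p | _ = p

opposite-inject₁ : (i : Fin n) → opposite (inject₁ i) ≡ suc (opposite i)
opposite-inject₁ zero    = refl
opposite-inject₁ (suc i) = cong inject₁ (opposite-inject₁ i)

opposite-fromℕ : ∀ n → opposite (fromℕ n) ≡ zero
opposite-fromℕ zero    = refl
opposite-fromℕ (suc n) = cong inject₁ (opposite-fromℕ n)

opposite-injective : Injective _≡_ _≡_ (opposite {n})
opposite-injective {x = i} {y = j} eq =
  trans (sym (opposite-involutive i))
        (trans (cong opposite eq) (opposite-involutive j))

module _ (D : Digraph n) where
  open Digraph D

  Source : Fin n → Set
  Source s = ∀ v → ¬ Arc v s

  module BackwardWalk
    (w : ℕ → Fin n) (arc : ∀ i → Arc (w (suc i)) (w i)) where

    -- The gap is `suc k`, so it is never zero, and the positions from `i` up to just before the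
    -- return are indexed by `Fin (suc k)`.
    Repetition : ℕ → ℕ → Set
    Repetition i k = w i ≡ w (suc k + i)

    -- The walk goes against the arcs, so `opposite` reverses the stretch to make it follow them. A
    -- gap of one would be a loop, which `loopless` excludes; every larger gap gives the two or more
    -- vertices that a `DirectedCycle` needs.
    injective⇒cycle : ∀ i k → Repetition i k →
      Injective _≡_ _≡_ (λ (a : Fin (suc k)) → w (toℕ a + i)) →
      DirectedCycle D
    injective⇒cycle i zero    rep _   = contradiction (arc i) (loopless (sym rep))
    injective⇒cycle i (suc m) rep inj = record
      { m        = m
      ; vertex   = λ a → at (opposite a)
      ; distinct = opposite-injective ∘ inj
      ; step     = λ a → subst₂ Arc
          (cong at (sym (opposite-inject₁ a)))
          (cong (λ l → w (l + i)) (sym (toℕ-inject₁ (opposite a))))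
          (arc (toℕ (opposite a) + i))
      -- After reversal the cycle ends at `w i`, which `rep` identifies with the walk's next vertex
      -- after the stretch; the arc from there leads to the cycle's first vertex.
      ; closing  = subst₂ Arc
          (trans (sym rep) (cong at (sym (opposite-fromℕ (suc m)))))
          (cong (λ l → w (l + i)) (sym (toℕ-fromℕ (suc m))))
          (arc (suc m + i))
      }
      where
      at : Fin (suc (suc m)) → Fin n
      at a = w (toℕ a + i)

    <⇒repetition : ∀ {i j} → i < j → w i ≡ w j → Repetition i (j ∸ suc i)
    <⇒repetition {i} {j} i<j eq =
      trans eq (cong w (sym (trans (sym (+-suc (j ∸ suc i) i)) (m∸n+n≡m i<j))))

    -- Strong induction on `k`, with `i` kept universal because a shorter repetition inside the
    -- stretch may start later.
    repetition⇒cycle : ∀ k i → Repetition i k → DirectedCycle D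
    repetition⇒cycle = <-rec _ go
      where
      go : ∀ k → (∀ {l} → l < k → ∀ i → Repetition i l → DirectedCycle D) →
           ∀ i → Repetition i k → DirectedCycle D
      go k rec i rep
        with any? {n = suc k} (λ a → any? {n = suc k} (λ b →
               (toℕ a <? toℕ b) ×-dec (w (toℕ a + i) ≟ w (toℕ b + i))))
      ... | yes (a , b , a<b , eq) =
        rec {toℕ b ∸ suc (toℕ a)} shorter (toℕ a + i)
          (trans eq (cong w
            (trans (cong (_+ i) (sym b≡)) (+-assoc (suc (toℕ b ∸ suc (toℕ a))) _ i))))
        where
        b≡ : suc (toℕ b ∸ suc (toℕ a)) + toℕ a ≡ toℕ b
        b≡ = trans (sym (+-suc _ _)) (m∸n+n≡m a<b)
        -- The index `b` is at most `k`, and subtracting the positive `suc (toℕ a)` makes it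
        -- strictly smaller.
        shorter : toℕ b ∸ suc (toℕ a) < k
        shorter = <-≤-trans (∸-monoʳ-< z<s a<b) (s≤s⁻¹ (toℕ<n b))
      ... | no none = injective⇒cycle i k rep inj
        where
        inj : Injective _≡_ _≡_ (λ (a : Fin (suc k)) → w (toℕ a + i))
        inj {a} {b} eq with <-cmp (toℕ a) (toℕ b)
        ... | tri< a<b _ _ = contradiction (a , b , a<b , eq) none
        ... | tri≈ _ a≡b _ = toℕ-injective a≡b
        ... | tri> _ _ b<a = contradiction (b , a , b<a , sym eq) none

    cycle : DirectedCycle D
    -- The first `suc n` positions of the walk take values among `n` vertices.
    cycle with pigeonhole (n<1+n n) (w ∘ toℕ)
    ... | i , j , i<j , eq = repetition⇒cycle _ (toℕ i) (<⇒repetition i<j eq)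

  -- The given vertex only serves to start the backward walk; this is where nonemptiness enters.
  acyclic⇒source : Fin n → Acyclic D → ∃ Source
  acyclic⇒source v₀ acyclic
    with any? (λ s → ¬? (any? λ v → Arc? v s))
  ... | yes (s , none) = s , λ v vs → none (v , vs)
  ... | no  noSource   = contradiction (BackwardWalk.cycle w arc) acyclic
    where
    -- Without sources, in-neighbours exist only up to double negation; the finite search over a
    -- decidable `Arc` yields an actual one.
    inNeighbour : ∀ v → ∃[ u ] Arc u v
    inNeighbour v =
      decidable-stable (any? λ u → Arc? u v) (λ none → noSource (v , none))
    w : ℕ → Fin n
    w zero    = v₀
    w (suc i) = proj₁ (inNeighbour (w i))
    arc : ∀ i → Arc (w (suc i)) (w i)
    arc i = proj₂ (inNeighbour (w i))

  -- A vertex `v` forcing `s` would have `s` in `N⁺ v`, hence an arc into the source.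
  source-unforced : ∀ {s} → Source s → ∀ t {S} → s ∉ S → s ∉ B D t S
  source-unforced         src zero    s∉S s∈S = s∉S s∈S
  source-unforced {s = s} src (suc t) {S} s∉S s∈
    with x∈p∪q⁻ (B D t S) _ s∈
  ... | inj₁ s∈B = source-unforced src t s∉S s∈B
  ... | inj₂ s∈forced with ∈-tabulate-does⁻ (forced? D (B D t S)) s∈forced
  ...   | v , _ , eq = src v (∈-tabulate-does⁻ (Arc? v)
            (p─q⊆p (N⁺ v) (B D t S) (subst (s ∈_) eq (x∈⁅x⁆ s))))

  FZFS⇒∣S∣≤n∸1 : ∀ S → FZFS D S → ∣ S ∣ ≤ n ∸ 1
  FZFS⇒∣S∣≤n∸1 S failed with m≤n⇒m<n∨m≡n (∣p∣≤n S)
  ... | inj₁ ∣S∣<n = <⇒≤pred ∣S∣<n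
  -- A set of full size is already everything at time `0`, hence zero forcing.
  ... | inj₂ ∣S∣≡n = contradiction (0 , ∣p∣≡n⇒p≡⊤ ∣S∣≡n) failed

  source⇒F≡n∸1 : ∃ Source → FailedZeroForcingNumberIs D (n ∸ 1)
  source⇒F≡n∸1 (s , src) = (∁ ⁅ s ⁆ , failed , size) , FZFS⇒∣S∣≤n∸1
    where
    failed : FZFS D (∁ ⁅ s ⁆)
    failed (t , B≡⊤) =
      source-unforced src t (x∈p⇒x∉∁p (x∈⁅x⁆ s)) (subst (s ∈_) (sym B≡⊤) ∈⊤)
    size : ∣ ∁ ⁅ s ⁆ ∣ ≡ n ∸ 1
    size = trans (∣∁p∣≡n∸∣p∣ ⁅ s ⁆) (cong (n ∸_) (∣⁅x⁆∣≡1 s))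

proposition4p2 : ∀ (n : ℕ) → n ≥ 1 → (D : Digraph n) → Acyclic D →
    FailedZeroForcingNumberIs D (n ∸ 1)
proposition4p2 (suc _) _ D acyclic =
  source⇒F≡n∸1 D (acyclic⇒source D zero acyclic)
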